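{- Every randomized algorithm for online graph exploration on cycles has competitive ratio at least $1+\frac{\sqrt{2}}{8+3\sqrt{2}}\approx 1.116$.
   Context: **Online exploration of cycles.** The input is a cycle $\Gamma$ (a cycle graph on $n\ge 3$ vertices) with non-negative edge weights $w$, together with a starting vertex $s$. An agent starts at $s$ and initially has no knowledge of the graph other than that it is a cycle. Whenever it visits a vertex for the first time (including $s$ at the start), it learns the identifiers of the adjacent vertices and the weights of the incident edges. The agent repeatedly decides which known edge to traverse next, based on the information revealed so far (and, for a randomized algorithm, on random choices); traversing an edge costs its weight. The agent must visit all vertices and return to $s$. Let $\mathrm{Alg}(\Gamma,s)$ be the total cost of an algorithm $\mathrm{Alg}$ (a random variable if $\mathrm{Alg}$ is randomized), and let $\mathrm{Opt}(\Gamma)$ be the minimum length of a closed walk in $\Gamma$ visiting every vertex. A randomized algorithm $\mathrm{Alg}$ is $\rho$-competitive (on cycles, against an oblivious adversary) if $\mathbb{E}[\mathrm{Alg}(\Gamma,s)]\le \rho\cdot \mathrm{Opt}(\Gamma)$ for every fixed weighted cycle $\Gamma$ and every starting vertex $s$. The competitive ratio of $\mathrm{Alg}$ is the infimum of all such $\rho$. -}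

module Defs where

open import Algebra.Bundles using (CommutativeRing)
import Algebra.Definitions.RawMonoid as RawMonoidDefinitions
open import Data.Empty using (⊥-elim)
open import Data.Fin using (Fin; toℕ)
import Data.Fin.Properties as Fin
open import Data.List using (List; []; _∷_)
open import Data.Nat as ℕ using (ℕ; zero; suc)
import Data.Nat.Properties as ℕ
open import Data.Nat.DivMod using (_mod_)
open import Data.Product using (Σ-syntax; ∃-syntax; _×_; _,_; proj₁; proj₂)
open import Data.Sum using (inj₁; inj₂)
open import Data.Bool using (true; false; if_then_else_)
open import Function.Definitions using (Injective)
open import Level using (Level; _⊔_) renaming (suc to lsuc)
open import Relation.Binary.Core using (Rel)
open import Relation.Binary.Definitions using (Cotransitive)
open import Relation.Binary.PropositionalEquality using (_≡_)
open import Relation.Binary.Structures using (IsStrictPartialOrder)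
open import Relation.Nullary using (Dec; does; ¬_; _×-dec_)

-- The library has no real numbers, so they are described axiomatically as
-- a Cauchy-complete Archimedean ordered field. The axioms are the
-- constructive ones: the Cauchy reals satisfy them without excluded middle,
-- and classically they determine ℝ up to isomorphism. The field `sqrt` is
-- a consequence of completeness, included so that √2 can be named.

record Reals (c ℓ₁ ℓ₂ : Level) : Set (lsuc (c ⊔ ℓ₁ ⊔ ℓ₂)) where
  infix 4 _<_ _≤_ _⟶_
  field
    commutativeRing : CommutativeRing c ℓ₁

  open CommutativeRing commutativeRing public
  open RawMonoidDefinitions +-rawMonoid public using () renaming (_×_ to _·_)

  field
    _<_                  : Rel Carrier ℓ₂
    isStrictPartialOrder : IsStrictPartialOrder _≈_ _<_
    <-cotrans            : Cotransitive _<_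
    <-tight              : ∀ {x y} → ¬ x < y → ¬ y < x → x ≈ y
    0<1                  : 0# < 1#
    +-monoˡ-<            : ∀ z {x y} → x < y → x + z < y + z
    *-pos                : ∀ {x y} → 0# < x → 0# < y → 0# < x * y
    inverse              : ∀ {x} → 0# < x → ∃[ y ] x * y ≈ 1#
    archimedean          : ∀ x → ∃[ n ] x < n · 1#

  _≤_ : Rel Carrier ℓ₂
  x ≤ y = ¬ y < x

  field
    sqrt : ∀ {x} → 0# ≤ x → ∃[ r ] 0# ≤ r × r * r ≈ x

  _⟶_ : (ℕ → Carrier) → Carrier → Set (c ⊔ ℓ₂)
  a ⟶ l = ∀ {ε} → 0# < ε →
    ∃[ N ] ∀ n → N ℕ.≤ n → a n < l + ε × l < a n + ε

  Cauchy : (ℕ → Carrier) → Set (c ⊔ ℓ₂)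
  Cauchy a = ∀ {ε} → 0# < ε →
    ∃[ N ] ∀ m n → N ℕ.≤ m → N ℕ.≤ n → a m < a n + ε

  field
    complete : ∀ a → Cauchy a → ∃[ l ] a ⟶ l

  IsMax : Carrier → Carrier → Carrier → Set (c ⊔ ℓ₂)
  IsMax x y m = x ≤ m × y ≤ m × (∀ z → x ≤ z → y ≤ z → m ≤ z)

  open IsStrictPartialOrder isStrictPartialOrder public
    using (irrefl; <-resp-≈) renaming (trans to <-trans; asym to <-asym)

  _/_[_] : Carrier → ∀ y → 0# < y → Carrier
  x / y [ 0<y ] = x * proj₁ (inverse 0<y)

  private
    0<x+y : ∀ {x y} → 0# < x → 0# ≤ y → 0# < x + y
    0<x+y {x} {y} 0<x 0≤y with <-cotrans (+-monoˡ-< y 0<x) 0#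
    ... | inj₁ 0+y<0 = ⊥-elim (0≤y (proj₂ <-resp-≈ (+-identityˡ y) 0+y<0))
    ... | inj₂ 0<x+y = 0<x+y

    0≤x+y : ∀ {x y} → 0# ≤ x → 0# ≤ y → 0# ≤ x + y
    0≤x+y {x} {y} 0≤x 0≤y x+y<0 with <-cotrans x+y<0 y
    ... | inj₂ y<0   = 0≤y y<0
    ... | inj₁ x+y<y = 0≤x
      (proj₁ <-resp-≈ (-‿inverseʳ y)
        (proj₂ <-resp-≈ (trans (+-assoc x y (- y))
                        (trans (+-congˡ (-‿inverseʳ y)) (+-identityʳ x)))
          (+-monoˡ-< (- y) x+y<y)))

    0≤n·x : ∀ n {x} → 0# ≤ x → 0# ≤ n · x
    0≤n·x zero    0≤x = irrefl refl
    0≤n·x (suc n) 0≤x = 0≤x+y 0≤x (0≤n·x n 0≤x)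

  √2 : Carrier
  √2 = proj₁ (sqrt (0≤n·x 2 (<-asym 0<1)))

  0<8+3√2 : 0# < 8 · 1# + 3 · √2
  0<8+3√2 = 0<x+y (0<x+y 0<1 (0≤n·x 7 (<-asym 0<1)))
    (0≤n·x 3 (proj₁ (proj₂ (sqrt (0≤n·x 2 (<-asym 0<1))))))

module _ {c ℓ₁ ℓ₂ : Level} (ℝ : Reals c ℓ₁ ℓ₂) where
  open Reals ℝ using (Carrier; _≈_; _+_; _*_; 0#; 1#; _<_; _≤_; _⟶_; IsMax)

  -- A probability space is given through its expectation (Daniell integral
  -- with E 1 = 1): by the Daniell–Stone theorem this is integration against
  -- a probability measure, and conversely every probability space is an
  -- instance, with all integrable random variables as `Integrable`.

  record ProbabilitySpace (a p : Level) :
         Set (lsuc (a ⊔ p) ⊔ c ⊔ ℓ₁ ⊔ ℓ₂) where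
    field
      Ω          : Set a
      Integrable : (Ω → Carrier) → Set p
      E          : ∀ X → Integrable X → Carrier

      constant : ∀ x → Integrable (λ _ → x)
      plus     : ∀ {X Y} → Integrable X → Integrable Y →
                 Integrable (λ ω → X ω + Y ω)
      scale    : ∀ x {X} → Integrable X → Integrable (λ ω → x * X ω)
      max      : ∀ {X Y Z} → Integrable X → Integrable Y →
                 (∀ ω → IsMax (X ω) (Y ω) (Z ω)) → Integrable Z

      E-one   : E (λ _ → 1#) (constant 1#) ≈ 1#
      E-plus  : ∀ {X Y} (i : Integrable X) (j : Integrable Y) →
                E (λ ω → X ω + Y ω) (plus i j) ≈ E X i + E Y j
      E-scale : ∀ x {X} (i : Integrable X) →
                E (λ ω → x * X ω) (scale x i) ≈ x * E X i
      E-mono  : ∀ {X Y} (i : Integrable X) (j : Integrable Y) →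
                (∀ ω → X ω ≤ Y ω) → E X i ≤ E Y j
      E-cont  : ∀ (X : ℕ → Ω → Carrier) (i : ∀ n → Integrable (X n)) →
                (∀ n ω → X (suc n) ω ≤ X n ω) →
                (∀ ω → (λ n → X n ω) ⟶ 0#) →
                (λ n → E (X n) (i n)) ⟶ 0#

  data Direction : Set where
    forward backward : Direction

  -- The vertices are Fin size in cyclic order; `weight v` is the weight of
  -- the edge from v to its successor. The cyclic numbering is not visible to
  -- the agent, who sees only the identifiers `ident v`.

  record Cycle : Set (c ⊔ ℓ₂) where
    field
      size-3          : ℕ

    size : ℕ
    size = 3 ℕ.+ size-3

    Vertex : Set
    Vertex = Fin size

    field
      ident           : Vertex → ℕ
      ident-injective : Injective _≡_ _≡_ ident
      weight          : Vertex → Carrier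
      weight-nonneg   : ∀ v → 0# ≤ weight v

    neighbour : Vertex → Direction → Vertex
    neighbour v forward  = (toℕ v ℕ.+ 1) mod size
    neighbour v backward = (toℕ v ℕ.+ (2 ℕ.+ size-3)) mod size

    edgeWeight : Vertex → Direction → Carrier
    edgeWeight v forward  = weight v
    edgeWeight v backward = weight (neighbour v backward)

    data Walk : Vertex → Vertex → Set where
      []  : ∀ {u} → Walk u u
      _∷_ : ∀ {u v} d → Walk (neighbour u d) v → Walk u v

    length : ∀ {u v} → Walk u v → Carrier
    length         []      = 0#
    length {u = u} (d ∷ p) = edgeWeight u d + length p

    data _∈ʷ_ (x : Vertex) : ∀ {u v} → Walk u v → Set where
      here  : ∀ {v} {p : Walk x v} → x ∈ʷ p
      there : ∀ {u v d} {p : Walk (neighbour u d) v} → x ∈ʷ p → x ∈ʷ (d ∷ p)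

    Tour : Set
    Tour = Σ[ u ∈ Vertex ] Σ[ p ∈ Walk u u ] (∀ x → x ∈ʷ p)

    tourLength : Tour → Carrier
    tourLength (_ , p , _) = length p

    IsOpt : Carrier → Set (ℓ₁ ⊔ ℓ₂)
    IsOpt o = (∃[ t ] tourLength t ≈ o) × (∀ t → o ≤ tourLength t)

  -- The two neighbours are presented in increasing order of identifier, so
  -- that the presentation reveals nothing about the orientation of the cycle.

  data Port : Set where
    lower higher : Port

  record View : Set c where
    constructor view
    field
      self                       : ℕ
      lowerIdent  higherIdent    : ℕ
      lowerWeight higherWeight   : Carrier

  -- The views at all positions so far, the current one first. It determines
  -- the past moves, since the neighbours of a vertex have distinct identifiers.

  History : Set c
  History = List View

  Strategy : Set c
  Strategy = History → Port

  module Exploration (Γ : Cycle) (s : Cycle.Vertex Γ) where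
    open Cycle Γ

    direction : Vertex → Port → Direction
    direction v port
      with does (ident (neighbour v backward) ℕ.<? ident (neighbour v forward))
         | port
    ... | true  | lower  = backward
    ... | true  | higher = forward
    ... | false | lower  = forward
    ... | false | higher = backward

    observe : Vertex → View
    observe v = view (ident v)
      (ident (neighbour v lo)) (ident (neighbour v hi))
      (edgeWeight v lo) (edgeWeight v hi)
      where
      lo hi : Direction
      lo = direction v lower
      hi = direction v higher

    module Run (σ : Strategy) where

      position : ℕ → Vertex
      history  : ℕ → History
      move     : ℕ → Direction

      position zero    = s
      position (suc t) = neighbour (position t) (move t)

      history zero    = observe s ∷ []
      history (suc t) = observe (position (suc t)) ∷ history t

      move t = direction (position t) (σ (history t))

      cost : ℕ → Carrier
      cost zero    = 0#
      cost (suc t) = cost t + edgeWeight (position t) (move t)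

      Complete : ℕ → Set
      Complete t = position t ≡ s ×
                   (∀ v → ∃[ i ] position (toℕ {suc t} i) ≡ v)

      complete? : ∀ t → Dec (Complete t)
      complete? t = position t Fin.≟ s ×-dec
                    Fin.all? (λ v → Fin.any? (λ i → position (toℕ i) Fin.≟ v))

      -- The exploration ends the first time that it is complete.
      EndsAt : ℕ → Set
      EndsAt t = Complete t × (∀ u → u ℕ.< t → ¬ Complete u)

      unfinished : ℕ → Carrier
      unfinished t =
        if does (Fin.any? {suc t} (λ i → complete? (toℕ i))) then 0# else 1#

  -- The agent must almost surely complete the exploration: `terminates` says
  -- that the probability of not having done so within t steps tends to 0.

  record RandomizedAlgorithm (a p : Level) :
         Set (lsuc (a ⊔ p) ⊔ c ⊔ ℓ₁ ⊔ ℓ₂) where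
    field
      space    : ProbabilitySpace a p

    open ProbabilitySpace space public

    field
      strategy : Ω → Strategy

    unfinished : ∀ Γ → Cycle.Vertex Γ → ℕ → Ω → Carrier
    unfinished Γ s t ω = Exploration.Run.unfinished Γ s (strategy ω) t

    field
      measurable : ∀ Γ s t → Integrable (unfinished Γ s t)
      terminates : ∀ Γ s →
        (λ t → E (unfinished Γ s t) (measurable Γ s t)) ⟶ 0#

    -- X is the total cost; on the null set of non-terminating runs it is only
    -- required to be non-negative.
    IsCost : ∀ Γ → Cycle.Vertex Γ → (Ω → Carrier) → Set (a ⊔ ℓ₁ ⊔ ℓ₂)
    IsCost Γ s X = ∀ ω → 0# ≤ X ω × (∀ t → EndsAt (strategy ω) t →
                                       X ω ≈ cost (strategy ω) t)
      where open Exploration.Run Γ s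

  module _ {a p : Level} (Alg : RandomizedAlgorithm a p) where
    open RandomizedAlgorithm Alg

    Competitive : Carrier → Set (a ⊔ p ⊔ c ⊔ ℓ₁ ⊔ ℓ₂)
    Competitive ρ = ∀ Γ s o → Cycle.IsOpt Γ o →
      Σ[ X ∈ (Ω → Carrier) ] Σ[ i ∈ Integrable X ]
        (IsCost Γ s X × E X i ≤ ρ * o)

    -- The competitive ratio is the infimum of the ρ for which the algorithm is
    -- competitive (∞ if there are none), so it is at least b exactly when b is
    -- a lower bound of these ρ.
    CompetitiveRatioAtLeast : Carrier → Set (a ⊔ p ⊔ c ⊔ ℓ₁ ⊔ ℓ₂)
    CompetitiveRatioAtLeast b = ∀ ρ → Competitive ρ → b ≤ ρ

{-# OPTIONS --safe #-}
-- Consider the cycles 0 – 1 – 2 – 3 – 0 with edges 01 and 30 of weight 1, both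
-- visible from the start 0, and edges 12 and 23 of weights (x, x), (x, 0) or
-- (0, x), where x = 2 + 2√2. Their optima are 2 + 2x, 4 and 4. Before it reaches
-- vertex 2, the agent on the (x, x) cycle either has visited both 1 and 3, and
-- then pays 4 + 2x in total, or it crosses an edge of weight x having seen only
-- one side of 0. In the latter case it has the same history, and hence makes
-- the same crossing, on the cycle with weight x on that side and 0 on the other,
-- where it pays 2 + x. So with weights √2, 1, 1 the total cost is at least
-- √2 (2 + 2x) + (2 + x) + 4 = √2 (4 + 2x) + 4 + 4 = 16 + 8√2 for every strategy
-- and hence in expectation, while the total optimum is 16 + 6√2.

module Submission where

open import Defs
open import Data.Bool using (Bool; true; false; if_then_else_)
open import Data.Empty using (⊥-elim)
open import Data.Fin using (Fin; toℕ)
open import Data.Fin.Patterns using (0F; 1F; 2F; 3F)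
open import Data.Fin.Properties using (all?; any?; toℕ-injective; toℕ≤pred[n]; _≟_)
open import Data.Fin.Subset using (Subset; inside; outside)
import Data.List as List
open import Data.Nat as ℕ using (ℕ; zero; suc; z≤n; s≤s; _≤‴_; ≤‴-refl; ≤‴-step)
import Data.Nat.Properties as ℕ
open import Data.Product using (∃; ∃-syntax; _×_; _,_; proj₁; proj₂; map₂)
open import Data.Sum as Sum using (_⊎_; inj₁; inj₂)
open import Data.Vec using ([]; _∷_; lookup)
open import Function using (_∘_)
open import Level using (Level; _⊔_)
open import Relation.Binary.PropositionalEquality as ≡ using (_≡_; _≢_)
open import Relation.Binary.Structures using (IsPreorder)
open import Relation.Nullary using (¬_; Dec; does; yes; no)
open import Relation.Nullary.Decidable using (from-yes)

-- Order and arithmetic in a constructive ordered field.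

module OrderedField {c ℓ₁ ℓ₂ : Level} (ℝ : Reals c ℓ₁ ℓ₂) where
  open Reals ℝ
  open import Algebra.Solver.Ring.NaturalCoefficients.Default commutativeSemiring public
    using (Polynomial; solve; con; _:+_; _:*_; _:=_)

  infixr 9 _:·_
  -- Unfolds exactly as `_·_` does, so that solver equations match goals stated with multiples
  -- `n · x`.
  _:·_ : ∀ {k} → ℕ → Polynomial k → Polynomial k
  zero  :· p = con 0
  suc n :· p = p :+ n :· p

  ≤-trans : ∀ {x y z} → x ≤ y → y ≤ z → x ≤ z
  ≤-trans {y = y} x≤y y≤z z<x with <-cotrans z<x y
  ... | inj₁ z<y = y≤z z<y
  ... | inj₂ y<x = x≤y y<x

  ≤-<-trans : ∀ {x y z} → x ≤ y → y < z → x < z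
  ≤-<-trans {x} x≤y y<z with <-cotrans y<z x
  ... | inj₁ y<x = ⊥-elim (x≤y y<x)
  ... | inj₂ x<z = x<z

  <-≤-trans : ∀ {x y z} → x < y → y ≤ z → x < z
  <-≤-trans {z = z} x<y y≤z with <-cotrans x<y z
  ... | inj₁ x<z = x<z
  ... | inj₂ z<y = ⊥-elim (y≤z z<y)

  ≤-reflexive : ∀ {x y} → x ≈ y → x ≤ y
  ≤-reflexive x≈y y<x = irrefl (sym x≈y) y<x

  ≤-refl : ∀ {x} → x ≤ x
  ≤-refl = ≤-reflexive refl

  ≤-isPreorder : IsPreorder _≈_ _≤_
  ≤-isPreorder = record
    { isEquivalence = isEquivalence
    ; reflexive     = ≤-reflexive
    ; trans         = ≤-trans
    }

  open import Relation.Binary.Reasoning.Base.Triple ≤-isPreorder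
    <-asym <-trans <-resp-≈ <-asym <-≤-trans ≤-<-trans public

  x+y-y≈x : ∀ x y → x + y + - y ≈ x
  x+y-y≈x x y = trans (+-assoc x y (- y)) (trans (+-congˡ (-‿inverseʳ y)) (+-identityʳ x))

  +-monoʳ-< : ∀ z {x y} → x < y → z + x < z + y
  +-monoʳ-< z {x} {y} x<y = begin-strict
    z + x ≈⟨ +-comm z x ⟩
    x + z <⟨ +-monoˡ-< z x<y ⟩
    y + z ≈⟨ +-comm y z ⟩
    z + y ∎

  +-monoˡ-≤ : ∀ z {x y} → x ≤ y → x + z ≤ y + z
  +-monoˡ-≤ z {x} {y} x≤y y+z<x+z = x≤y (begin-strict
    y             ≈⟨ x+y-y≈x y z ⟨
    y + z + - z   <⟨ +-monoˡ-< (- z) y+z<x+z ⟩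
    x + z + - z   ≈⟨ x+y-y≈x x z ⟩
    x             ∎)

  +-mono-≤ : ∀ {x y u v} → x ≤ y → u ≤ v → x + u ≤ y + v
  +-mono-≤ {x} {y} {u} {v} x≤y u≤v = begin
    x + u ≤⟨ +-monoˡ-≤ u x≤y ⟩
    y + u ≈⟨ +-comm y u ⟩
    u + y ≤⟨ +-monoˡ-≤ y u≤v ⟩
    v + y ≈⟨ +-comm v y ⟩
    y + v ∎

  +-monoʳ-≤ : ∀ z {x y} → x ≤ y → z + x ≤ z + y
  +-monoʳ-≤ z = +-mono-≤ ≤-refl

  +-mono-< : ∀ {x y u v} → x < y → u < v → x + u < y + v
  +-mono-< {y = y} {u} x<y u<v = <-trans (+-monoˡ-< u x<y) (+-monoʳ-< y u<v)

  +-nonneg : ∀ {x y} → 0# ≤ x → 0# ≤ y → 0# ≤ x + y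
  +-nonneg {x} {y} 0≤x 0≤y = begin
    0#      ≈⟨ +-identityˡ 0# ⟨
    0# + 0# ≤⟨ +-mono-≤ 0≤x 0≤y ⟩
    x + y   ∎

  y≤x+y : ∀ {x} y → 0# ≤ x → y ≤ x + y
  y≤x+y {x} y 0≤x = begin
    y      ≈⟨ +-identityˡ y ⟨
    0# + y ≤⟨ +-monoˡ-≤ y 0≤x ⟩
    x + y  ∎

  x≤x+y : ∀ x {y} → 0# ≤ y → x ≤ x + y
  x≤x+y x {y} 0≤y = begin
    x      ≈⟨ +-identityʳ x ⟨
    x + 0# ≤⟨ +-monoʳ-≤ x 0≤y ⟩
    x + y  ∎

  -- The claim is a negation, so positivity of both factors may be used under double negation. A
  -- factor that is not positive equals 0 by tightness, and then so does the product.
  *-nonneg : ∀ {x y} → 0# ≤ x → 0# ≤ y → 0# ≤ x * y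
  *-nonneg {x} {y} 0≤x 0≤y xy<0 = y≮ λ 0<y → x≮ λ 0<x → <-asym xy<0 (*-pos 0<x 0<y)
    where
    x≮ : ¬ ¬ 0# < x
    x≮ 0≮x = irrefl (trans (*-congʳ (sym (<-tight 0≮x 0≤x))) (zeroˡ y)) xy<0

    y≮ : ¬ ¬ 0# < y
    y≮ 0≮y = irrefl (trans (*-congˡ (sym (<-tight 0≮y 0≤y))) (zeroʳ x)) xy<0

  y≈x+[y-x] : ∀ x y → y ≈ x + (y + - x)
  y≈x+[y-x] x y = sym (trans (+-comm x (y + - x))
    (trans (+-assoc y (- x) x) (trans (+-congˡ (-‿inverseˡ x)) (+-identityʳ y))))

  x≤y⇒0≤y-x : ∀ {x y} → x ≤ y → 0# ≤ y + - x
  x≤y⇒0≤y-x {x} {y} x≤y = begin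
    0#      ≈⟨ -‿inverseʳ x ⟨
    x + - x ≤⟨ +-monoˡ-≤ (- x) x≤y ⟩
    y + - x ∎

  x<y⇒0<y-x : ∀ {x y} → x < y → 0# < y + - x
  x<y⇒0<y-x {x} {y} x<y = begin-strict
    0#      ≈⟨ -‿inverseʳ x ⟨
    x + - x <⟨ +-monoˡ-< (- x) x<y ⟩
    y + - x ∎

  *-monoˡ-≤ : ∀ {z} → 0# ≤ z → ∀ {x y} → x ≤ y → z * x ≤ z * y
  *-monoˡ-≤ {z} 0≤z {x} {y} x≤y = begin
    z * x                    ≤⟨ x≤x+y (z * x) (*-nonneg 0≤z (x≤y⇒0≤y-x x≤y)) ⟩
    z * x + z * (y + - x)    ≈⟨ distribˡ z x (y + - x) ⟨
    z * (x + (y + - x))      ≈⟨ *-congˡ (y≈x+[y-x] x y) ⟨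
    z * y                    ∎

  *-monoˡ-< : ∀ {z} → 0# < z → ∀ {x y} → x < y → z * x < z * y
  *-monoˡ-< {z} 0<z {x} {y} x<y = begin-strict
    z * x                    ≈⟨ +-identityʳ (z * x) ⟨
    z * x + 0#               <⟨ +-monoʳ-< (z * x) (*-pos 0<z (x<y⇒0<y-x x<y)) ⟩
    z * x + z * (y + - x)    ≈⟨ distribˡ z x (y + - x) ⟨
    z * (x + (y + - x))      ≈⟨ *-congˡ (y≈x+[y-x] x y) ⟨
    z * y                    ∎

  ·-nonneg : ∀ n {x} → 0# ≤ x → 0# ≤ n · x
  ·-nonneg zero    0≤x = ≤-refl
  ·-nonneg (suc n) 0≤x = +-nonneg 0≤x (·-nonneg n 0≤x)

  ·-mono-≤ : ∀ {m n} {x} → 0# ≤ x → m ℕ.≤ n → m · x ≤ n · x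
  ·-mono-≤ {n = n} 0≤x z≤n       = ·-nonneg n 0≤x
  ·-mono-≤         0≤x (s≤s m≤n) = +-monoʳ-≤ _ (·-mono-≤ 0≤x m≤n)

  ·-distribʳ-+ : ∀ x m n → (m ℕ.+ n) · x ≈ m · x + n · x
  ·-distribʳ-+ x zero    n = sym (+-identityˡ (n · x))
  ·-distribʳ-+ x (suc m) n = trans (+-congˡ (·-distribʳ-+ x m n)) (sym (+-assoc x (m · x) (n · x)))

  0≤1 : 0# ≤ 1#
  0≤1 = <-asym 0<1

-- Cut pseudometrics, and least witnesses of decidable predicates.

differ : Bool → Bool → ℕ
differ true  true  = 0
differ false false = 0
differ _     _     = 1

differ-refl : ∀ x → differ x x ≡ 0
differ-refl true  = ≡.refl
differ-refl false = ≡.refl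

differ-comm : ∀ x y → differ x y ≡ differ y x
differ-comm true  true  = ≡.refl
differ-comm true  false = ≡.refl
differ-comm false true  = ≡.refl
differ-comm false false = ≡.refl

differ-triangle : ∀ x y z → differ x z ℕ.≤ differ x y ℕ.+ differ y z
differ-triangle true  true  z     = ℕ.≤-refl
differ-triangle false false z     = ℕ.≤-refl
differ-triangle true  false true  = z≤n
differ-triangle true  false false = ℕ.≤-refl
differ-triangle false true  true  = ℕ.≤-refl
differ-triangle false true  false = z≤n

-- The pseudometric of the cut `S`. Its values are numbers so that they can be summed along a walk.
separates : ∀ {n} → Subset n → Fin n → Fin n → ℕ
separates S u v = differ (lookup S u) (lookup S v)

separates-refl : ∀ {n} (S : Subset n) u → separates S u u ≡ 0
separates-refl S u = differ-refl (lookup S u)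

separates-comm : ∀ {n} (S : Subset n) u v → separates S u v ≡ separates S v u
separates-comm S u v = differ-comm (lookup S u) (lookup S v)

separates-triangle : ∀ {n} (S : Subset n) u v w →
                     separates S u w ℕ.≤ separates S u v ℕ.+ separates S v w
separates-triangle S u v w = differ-triangle (lookup S u) (lookup S v) (lookup S w)

-- Nontriviality of the cut, seen from every base vertex, as a closed walk may start on either side.
Splits : ∀ {n} → Subset n → Set
Splits S = ∀ u → ∃[ x ] separates S u x ≡ 1

splits? : ∀ {n} (S : Subset n) → Dec (Splits S)
splits? S = all? λ u → any? λ x → separates S u x ℕ.≟ 1

smallest : ∀ {p} {P : ℕ → Set p} → (∀ n → Dec (P n)) → ∀ n → P n →
           ∃[ m ] m ℕ.≤ n × P m × (∀ i → i ℕ.< m → ¬ P i)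
smallest P? zero    p = zero , z≤n , p , λ _ ()
smallest P? (suc n) p with P? zero
... | yes p₀ = zero , z≤n , p₀ , λ _ ()
... | no ¬p₀ with smallest (P? ∘ suc) n p
... | m , m≤n , pₘ , below = suc m , s≤s m≤n , pₘ , λ where
  zero    _         → ¬p₀
  (suc i) (s≤s i<m) → below i i<m

-- Lower bounds on walk lengths from cuts.

module Cuts {c ℓ₁ ℓ₂ : Level} (ℝ : Reals c ℓ₁ ℓ₂) (Γ : Cycle ℝ) where
  open Reals ℝ hiding (zero)
  open OrderedField ℝ
  open Cycle Γ

  crossings : ∀ (S : Subset size) {u v} → Walk u v → ℕ
  crossings S         []      = 0
  crossings S {u = u} (d ∷ p) = separates S u (neighbour u d) ℕ.+ crossings S p

  separates≤crossings : ∀ S {u v} (p : Walk u v) → separates S u v ℕ.≤ crossings S p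
  separates≤crossings S {u}     []      = ℕ.≤-reflexive (separates-refl S u)
  separates≤crossings S {u} {v} (d ∷ p) = ℕ.≤-trans
    (separates-triangle S u (neighbour u d) v)
    (ℕ.+-monoʳ-≤ (separates S u (neighbour u d)) (separates≤crossings S p))

  -- The triangle inequality absorbs the steps before the visit to `x`, and `separates≤crossings`
  -- bounds the rest.
  crossings-via : ∀ S {x u v} {p : Walk u v} → x ∈ʷ p →
                  separates S u x ℕ.+ separates S x v ℕ.≤ crossings S p
  crossings-via S {x} {p = p} here
    rewrite separates-refl S x = separates≤crossings S p
  crossings-via S {x} {u} {v} (there {d = d} {p = p} x∈p) = ℕ.≤-trans
    (ℕ.+-monoˡ-≤ (separates S x v) (separates-triangle S u w x))
    (ℕ.≤-trans (ℕ.≤-reflexive (ℕ.+-assoc (separates S u w) (separates S w x) _))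
      (ℕ.+-monoʳ-≤ (separates S u w) (crossings-via S x∈p)))
    where w = neighbour u d

  -- A closed walk has to reach a vertex on the other side and come back. Closedness is an equation
  -- because the last position of a run is only propositionally equal to the start.
  closed⇒2≤crossings : ∀ {S} → Splits S → ∀ {u v} {p : Walk u v} → u ≡ v →
                       (∀ x → x ∈ʷ p) → 2 ℕ.≤ crossings S p
  closed⇒2≤crossings {S} splits {u} {p = p} ≡.refl all with splits u
  ... | x , u|x = ≡.subst (ℕ._≤ crossings S p)
    (≡.cong₂ ℕ._+_ u|x (≡.trans (separates-comm S x u) u|x))
    (crossings-via S (all x))

  -- A fractional packing of two cuts into the edge weights: every lower bound
  -- on lengths below comes from counting how often a walk crosses the two cuts.
  record CutPacking : Set (c ⊔ ℓ₂) where
    field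
      S T : Subset size
      κ τ : Carrier
      κ-nonneg : 0# ≤ κ
      τ-nonneg : 0# ≤ τ
      packs : ∀ v d → separates S v (neighbour v d) · κ + separates T v (neighbour v d) · τ
                      ≤ edgeWeight v d

    -- A lower bound for the distance in the weighted cycle: a weighted sum of two cut pseudometrics
    -- which, by `packs`, is at most the weight of every edge.
    dist : Vertex → Vertex → Carrier
    dist u v = separates S u v · κ + separates T u v · τ

    dist-nonneg : ∀ u v → 0# ≤ dist u v
    dist-nonneg u v = +-nonneg (·-nonneg (separates S u v) κ-nonneg)
                               (·-nonneg (separates T u v) τ-nonneg)

    crossings≤length : ∀ {u v} (p : Walk u v) →
                       crossings S p · κ + crossings T p · τ ≤ length p
    crossings≤length []                = ≤-reflexive (+-identityˡ 0#)
    crossings≤length {u} (d ∷ p) = begin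
      (m ℕ.+ m′) · κ + (n ℕ.+ n′) · τ         ≈⟨ +-cong (·-distribʳ-+ κ m m′) (·-distribʳ-+ τ n n′) ⟩
      (m · κ + m′ · κ) + (n · τ + n′ · τ)     ≈⟨ solve 4 (λ w x y z → (w :+ x) :+ (y :+ z) := (w :+ y) :+ (x :+ z)) refl _ _ _ _ ⟩
      (m · κ + n · τ) + (m′ · κ + n′ · τ)     ≤⟨ +-mono-≤ (packs u d) (crossings≤length p) ⟩
      edgeWeight u d + length p               ∎
      where
      m  = separates S u (neighbour u d)
      n  = separates T u (neighbour u d)
      m′ = crossings S p
      n′ = crossings T p

    dist≤length : ∀ {u v} (p : Walk u v) → dist u v ≤ length p
    dist≤length p = ≤-trans
      (+-mono-≤ (·-mono-≤ κ-nonneg (separates≤crossings S p))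
                (·-mono-≤ τ-nonneg (separates≤crossings T p)))
      (crossings≤length p)

    -- Weak duality for tours: each cut is crossed at least twice, so a packing can certify that a
    -- tour is optimal.
    closed⇒≤length : Splits S → Splits T → ∀ {u v} (p : Walk u v) → u ≡ v →
                     (∀ x → x ∈ʷ p) → 2 · κ + 2 · τ ≤ length p
    closed⇒≤length splitsS splitsT p u≡v all = ≤-trans
      (+-mono-≤ (·-mono-≤ κ-nonneg (closed⇒2≤crossings splitsS u≡v all))
                (·-mono-≤ τ-nonneg (closed⇒2≤crossings splitsT u≡v all)))
      (crossings≤length p)

-- Runs of a strategy, read as walks.

module Runs {c ℓ₁ ℓ₂ : Level} (ℝ : Reals c ℓ₁ ℓ₂) (Γ : Cycle ℝ) (s : Cycle.Vertex Γ)
            (σ : Strategy ℝ) where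
  open Reals ℝ hiding (zero)
  open OrderedField ℝ
  open Cycle Γ
  open Cuts ℝ Γ
  open Exploration ℝ Γ s
  open Run σ

  -- `_≤‴_` recurses at its lower end, just as a walk does at its first step.
  trace : ∀ {i j} → i ≤‴ j → Walk (position i) (position j)
  trace     ≤‴-refl       = []
  trace {i} (≤‴-step i<j) = move i ∷ trace i<j

  cost-trace : ∀ {i j} (i≤j : i ≤‴ j) → cost i + length (trace i≤j) ≈ cost j
  cost-trace     ≤‴-refl       = +-identityʳ _
  cost-trace {i} (≤‴-step i<j) = trans
    (sym (+-assoc (cost i) (edgeWeight (position i) (move i)) (length (trace i<j))))
    (cost-trace i<j)

  ∈-trace : ∀ {i j} (i≤j : i ≤‴ j) {k} → i ℕ.≤ k → k ℕ.≤ j → position k ∈ʷ trace i≤j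
  ∈-trace ≤‴-refl i≤k k≤i with ℕ.≤-antisym i≤k k≤i
  ... | ≡.refl = here
  ∈-trace (≤‴-step i<j) i≤k k≤j with ℕ.m≤n⇒m<n∨m≡n i≤k
  ... | inj₁ i<k    = there (∈-trace i<j i<k k≤j)
  ... | inj₂ ≡.refl = here

  complete⇒∈-trace : ∀ {t} → Complete t → ∀ x → x ∈ʷ trace (ℕ.0≤‴n {t})
  complete⇒∈-trace (_ , all) x with all x
  ... | i , ≡.refl = ∈-trace ℕ.0≤‴n z≤n (toℕ≤pred[n] i)

  module _ (𝒞 : CutPacking) where
    open CutPacking 𝒞

    dist≤cost : ∀ {i j u v} → i ℕ.≤ j → position i ≡ u → position j ≡ v →
                cost i + dist u v ≤ cost j
    dist≤cost {i} {j} i≤j ≡.refl ≡.refl = begin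
      cost i + dist (position i) (position j) ≤⟨ +-monoʳ-≤ (cost i) (dist≤length p) ⟩
      cost i + length p                       ≈⟨ cost-trace (ℕ.≤⇒≤‴ i≤j) ⟩
      cost j                                  ∎
      where p = trace (ℕ.≤⇒≤‴ i≤j)

    cost-mono : ∀ {i j} → i ℕ.≤ j → cost i ≤ cost j
    cost-mono i≤j = ≤-trans (x≤x+y _ (dist-nonneg _ _)) (dist≤cost i≤j ≡.refl ≡.refl)

    complete⇒≤cost : Splits S → Splits T → ∀ {t} → Complete t → 2 · κ + 2 · τ ≤ cost t
    complete⇒≤cost splitsS splitsT {t} complete = begin
      2 · κ + 2 · τ  ≤⟨ closed⇒≤length splitsS splitsT p
                         (≡.sym (proj₁ complete)) (complete⇒∈-trace complete) ⟩
      length p       ≈⟨ +-identityˡ (length p) ⟨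
      0# + length p  ≈⟨ cost-trace (ℕ.0≤‴n {t}) ⟩
      cost t         ∎
      where p = trace (ℕ.0≤‴n {t})

  visits : ∀ {t} → Complete t → ∀ v → ∃[ i ] i ℕ.≤ t × position i ≡ v
  visits (_ , all) v with all v
  ... | i , eq = toℕ i , toℕ≤pred[n] i , eq

  -- If the indicator is 0, the exploration is complete at some time up to `t`, and the first such
  -- time is where it ends.
  unfinished-cases : ∀ t → unfinished t ≡ 1# ⊎ (unfinished t ≡ 0# × ∃ EndsAt)
  unfinished-cases t = Sum.map₂ (map₂ ends) (if-cases (any? {suc t} (λ i → complete? (toℕ i))))
    where
    if-cases : ∀ {P : Set} (P? : Dec P) → let u = if does P? then 0# else 1# in
               u ≡ 1# ⊎ (u ≡ 0# × P)
    if-cases (yes p) = inj₂ (≡.refl , p)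
    if-cases (no _)  = inj₁ ≡.refl

    ends : ∃[ i ] Complete (toℕ {suc t} i) → ∃ EndsAt
    ends (i , complete) with smallest complete? (toℕ i) complete
    ... | u , _ , endsAt = u , endsAt

-- Four-cycles and indistinguishable runs.

module FourCycles {c ℓ₁ ℓ₂ : Level} (ℝ : Reals c ℓ₁ ℓ₂) where
  open Reals ℝ hiding (zero)
  open OrderedField ℝ

  NonNegative : Set (c ⊔ ℓ₂)
  NonNegative = ∃[ x ] 0# ≤ x

  fourCycle : NonNegative → NonNegative → Cycle ℝ
  fourCycle (a , 0≤a) (b , 0≤b) = record
    { size-3          = 1
    ; ident           = toℕ
    ; ident-injective = toℕ-injective
    ; weight          = λ { 0F → 1# ; 1F → a ; 2F → b ; 3F → 1# }
    ; weight-nonneg   = λ { 0F → 0≤1 ; 1F → 0≤a ; 2F → 0≤b ; 3F → 0≤1 }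
    }

  module _ (a b : NonNegative) where
    open Cycle (fourCycle a b)
    open Cuts ℝ (fourCycle a b)

    -- Every edge is the forward edge of one of its ends, so symmetry of `separates` covers the
    -- backward directions.
    packing : (S T : Subset 4) ((κ , _) (τ , _) : NonNegative) →
      (∀ v → separates S v (neighbour v forward) · κ + separates T v (neighbour v forward) · τ
             ≤ weight v) →
      CutPacking
    packing S T (κ , 0≤κ) (τ , 0≤τ) packs = record
      { S = S ; T = T ; κ = κ ; τ = τ ; κ-nonneg = 0≤κ ; τ-nonneg = 0≤τ
      ; packs = λ { v forward → packs v ; v backward → packs-backward v }
      }
      where
      backward-forward : ∀ v → neighbour (neighbour v backward) forward ≡ v
      backward-forward = λ { 0F → ≡.refl ; 1F → ≡.refl ; 2F → ≡.refl ; 3F → ≡.refl }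

      packs-backward : ∀ v → separates S v (neighbour v backward) · κ
                           + separates T v (neighbour v backward) · τ
                           ≤ weight (neighbour v backward)
      packs-backward v = ≡.subst (_≤ weight u)
        (≡.cong₂ (λ m n → m · κ + n · τ)
          (≡.trans (separates-comm S u _) (≡.cong (λ w → separates S w u) (backward-forward v)))
          (≡.trans (separates-comm T u _) (≡.cong (λ w → separates T w u) (backward-forward v))))
        (packs u)
        where u = neighbour v backward

  module _ (a b a′ b′ : NonNegative) (σ : Strategy ℝ) where
    private
      module G  = Exploration ℝ (fourCycle a b) 0F
      module G′ = Exploration ℝ (fourCycle a′ b′) 0F
      module R  = G.Run σ
      module R′ = G′.Run σ

    -- Identifiers do not depend on the weights, so a port leads to the same vertex in both cycles.
    successor-≡ : ∀ v port → Cycle.neighbour (fourCycle a′ b′) v (G′.direction v port)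
                      ≡ Cycle.neighbour (fourCycle a b) v (G.direction v port)
    successor-≡ 0F lower  = ≡.refl
    successor-≡ 0F higher = ≡.refl
    successor-≡ 1F lower  = ≡.refl
    successor-≡ 1F higher = ≡.refl
    successor-≡ 2F lower  = ≡.refl
    successor-≡ 2F higher = ≡.refl
    successor-≡ 3F lower  = ≡.refl
    successor-≡ 3F higher = ≡.refl

    -- Induction on time, jointly with `history-≡`. The position at `t` depends only on the views at
    -- earlier times, the history also on the view at `t`; hence `<` here and `≤` there.
    position-≡ : ∀ t → (∀ i → i ℕ.< t → G′.observe (R.position i) ≡ G.observe (R.position i)) →
                 R′.position t ≡ R.position t
    history-≡ : ∀ t → (∀ i → i ℕ.≤ t → G′.observe (R.position i) ≡ G.observe (R.position i)) →
                R′.history t ≡ R.history t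

    position-≡ zero    same = ≡.refl
    position-≡ (suc t) same = ≡.trans
      (≡.cong₂ (λ v h → Cycle.neighbour (fourCycle a′ b′) v (G′.direction v (σ h)))
        (position-≡ t λ i i<t → same i (ℕ.m<n⇒m<1+n i<t))
        (history-≡ t λ i i≤t → same i (s≤s i≤t)))
      (successor-≡ (R.position t) (σ (R.history t)))

    history-≡ zero    same = ≡.cong (List._∷ List.[]) (same 0 z≤n)
    history-≡ (suc t) same = ≡.cong₂ List._∷_
      (≡.trans (≡.cong G′.observe (position-≡ (suc t) λ i i<1+t → same i (ℕ.<⇒≤ i<1+t)))
               (same (suc t) ℕ.≤-refl))
      (history-≡ t λ i i≤t → same i (ℕ.m≤n⇒m≤1+n i≤t))

-- The three cycles: their optima and the possible runs.

module HeavyCycles {c ℓ₁ ℓ₂ : Level} (ℝ : Reals c ℓ₁ ℓ₂)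
                   (𝓍 : FourCycles.NonNegative ℝ)
                   (2≤x : Reals._≤_ ℝ (Reals._·_ ℝ 2 (Reals.1# ℝ)) (proj₁ 𝓍)) where
  open Reals ℝ hiding (zero)
  open OrderedField ℝ
  open FourCycles ℝ

  x = proj₁ 𝓍


  𝟘 𝟙 : NonNegative
  𝟘 = 0# , ≤-refl
  𝟙 = 1# , 0≤1

  balanced left right : Cycle ℝ
  balanced = fourCycle 𝓍 𝓍
  right    = fourCycle 𝓍 𝟘
  left     = fourCycle 𝟘 𝓍

  ⟨0⟩ ⟨1⟩ ⟨2⟩ ⟨3⟩ ⟨01⟩ ⟨03⟩ : Subset 4
  ⟨0⟩  = inside  ∷ outside ∷ outside ∷ outside ∷ []
  ⟨1⟩  = outside ∷ inside  ∷ outside ∷ outside ∷ []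
  ⟨2⟩  = outside ∷ outside ∷ inside  ∷ outside ∷ []
  ⟨3⟩  = outside ∷ outside ∷ outside ∷ inside  ∷ []
  ⟨01⟩ = inside  ∷ inside  ∷ outside ∷ outside ∷ []
  ⟨03⟩ = inside  ∷ outside ∷ outside ∷ inside  ∷ []

  first≈ : ∀ y → 1 · y + 0# ≈ y
  first≈ y = trans (+-identityʳ (1 · y)) (+-identityʳ y)

  second≈ : ∀ y → 0# + 1 · y ≈ y
  second≈ y = trans (+-identityˡ (1 · y)) (+-identityʳ y)

  both≈ : 1 · 1# + 1 · 1# ≈ 2 · 1#
  both≈ = solve 0 (1 :· con 1 :+ 1 :· con 1 := 2 :· con 1) refl

  1≤x : 1# ≤ x
  1≤x = ≤-trans (x≤x+y 1# (·-nonneg 1 0≤1)) 2≤x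

  -- The first packing exhausts the weight of every edge and certifies the optimum. The second gives
  -- distance 1 from 0 to each of 1 and 3 and distance 2 between these, so it measures the cost of
  -- visiting both.
  balanced-opt-packing balanced-path-packing : Cuts.CutPacking ℝ balanced
  balanced-opt-packing = packing 𝓍 𝓍 ⟨0⟩ ⟨2⟩ 𝟙 𝓍 λ where
    0F → ≤-reflexive (first≈ 1#)
    1F → ≤-reflexive (second≈ x)
    2F → ≤-reflexive (second≈ x)
    3F → ≤-reflexive (first≈ 1#)
  balanced-path-packing = packing 𝓍 𝓍 ⟨01⟩ ⟨03⟩ 𝟙 𝟙 λ where
    0F → ≤-reflexive (second≈ 1#)
    1F → ≤-trans (≤-reflexive (first≈ 1#)) 1≤x
    2F → ≤-trans (≤-reflexive (second≈ 1#)) 1≤x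
    3F → ≤-reflexive (first≈ 1#)

  -- Both cuts contain the heavy edge 12, which has room for them by `2≤x`. Neither contains the
  -- edge 23 of weight 0.
  right-packing : Cuts.CutPacking ℝ right
  right-packing = packing 𝓍 𝟘 ⟨1⟩ ⟨01⟩ 𝟙 𝟙 λ where
    0F → ≤-reflexive (first≈ 1#)
    1F → ≤-trans (≤-reflexive both≈) 2≤x
    2F → ≤-reflexive (+-identityˡ 0#)
    3F → ≤-reflexive (second≈ 1#)

  left-packing : Cuts.CutPacking ℝ left
  left-packing = packing 𝟘 𝓍 ⟨3⟩ ⟨03⟩ 𝟙 𝟙 λ where
    0F → ≤-reflexive (second≈ 1#)
    1F → ≤-reflexive (+-identityˡ 0#)
    2F → ≤-trans (≤-reflexive both≈) 2≤x
    3F → ≤-reflexive (first≈ 1#)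

  splits-0 : Splits ⟨0⟩
  splits-0 = from-yes (splits? ⟨0⟩)

  splits-1 : Splits ⟨1⟩
  splits-1 = from-yes (splits? ⟨1⟩)

  splits-2 : Splits ⟨2⟩
  splits-2 = from-yes (splits? ⟨2⟩)

  splits-3 : Splits ⟨3⟩
  splits-3 = from-yes (splits? ⟨3⟩)

  splits-01 : Splits ⟨01⟩
  splits-01 = from-yes (splits? ⟨01⟩)

  splits-03 : Splits ⟨03⟩
  splits-03 = from-yes (splits? ⟨03⟩)

  balanced-opt : Cycle.IsOpt balanced (2 · 1# + 2 · x)
  balanced-opt = ((0F , round , visits) , round-length)
    , λ { (_ , p , all) → closed⇒≤length splits-0 splits-2 p ≡.refl all }
    where
    open Cycle balanced
    open Cuts.CutPacking balanced-opt-packing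
    round : Walk 0F 0F
    round = forward ∷ forward ∷ forward ∷ forward ∷ []
    visits : ∀ v → v ∈ʷ round
    visits = λ { 0F → here ; 1F → there here ; 2F → there (there here)
               ; 3F → there (there (there here)) }
    round-length : length round ≈ 2 · 1# + 2 · x
    round-length = solve 1 (λ x → con 1 :+ (x :+ (x :+ (con 1 :+ con 0))) := 2 :· con 1 :+ 2 :· x) refl x

  right-opt : Cycle.IsOpt right (2 · 1# + 2 · 1#)
  right-opt = ((0F , path , visits) , path-length)
    , λ { (_ , p , all) → closed⇒≤length splits-1 splits-01 p ≡.refl all }
    where
    open Cycle right
    open Cuts.CutPacking right-packing
    path : Walk 0F 0F
    -- The walk 0, 1, 0, 3, 2, 3, 0 avoids the heavy edge 12.
    path = forward ∷ backward ∷ backward ∷ backward ∷ forward ∷ forward ∷ []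
    visits : ∀ v → v ∈ʷ path
    visits = λ { 0F → here ; 1F → there here ; 3F → there (there (there here))
               ; 2F → there (there (there (there here))) }
    path-length : length path ≈ 2 · 1# + 2 · 1#
    path-length = solve 0 (con 1 :+ (con 1 :+ (con 1 :+ (con 0 :+ (con 0 :+ (con 1 :+ con 0))))) := 2 :· con 1 :+ 2 :· con 1) refl

  left-opt : Cycle.IsOpt left (2 · 1# + 2 · 1#)
  left-opt = ((0F , path , visits) , path-length)
    , λ { (_ , p , all) → closed⇒≤length splits-3 splits-03 p ≡.refl all }
    where
    open Cycle left
    open Cuts.CutPacking left-packing
    path : Walk 0F 0F
    -- The mirror image 0, 3, 0, 1, 2, 1, 0 avoids the heavy edge 23.
    path = backward ∷ forward ∷ forward ∷ forward ∷ backward ∷ backward ∷ []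
    visits : ∀ v → v ∈ʷ path
    visits = λ { 0F → here ; 3F → there here ; 1F → there (there (there here))
               ; 2F → there (there (there (there here))) }
    path-length : length path ≈ 2 · 1# + 2 · 1#
    path-length = solve 0 (con 1 :+ (con 1 :+ (con 1 :+ (con 0 :+ (con 0 :+ (con 1 :+ con 0))))) := 2 :· con 1 :+ 2 :· con 1) refl

  -- Costs of one strategy in the balanced, the right and the left cycle.
  data Outcome (A R L : Carrier) : Set ℓ₂ where
    slow       : 4 · 1# + 2 · x ≤ A → Outcome A R L
    fast-right : 2 · 1# + x ≤ R → Outcome A R L
    fast-left  : 2 · 1# + x ≤ L → Outcome A R L

  module _ (σ : Strategy ℝ) where
    module Balanced where
      open Exploration ℝ balanced 0F public
      open Run σ public
      open Runs ℝ balanced 0F σ public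

    module Right where
      open Exploration ℝ right 0F public
      open Run σ public
      open Runs ℝ right 0F σ public

    module Left where
      open Exploration ℝ left 0F public
      open Run σ public
      open Runs ℝ left 0F σ public

    -- In use, `u` and `v` are the vertices 1 and 3 in the order of their visits. The path packing
    -- charges 1 and then 2 for reaching them, the step into 2 costs `x`, and the optimum packing
    -- charges `1 + x` for the return.
    balanced-slow : ∀ {i j t n u v} →
      let open Cuts.CutPacking balanced-path-packing in let open Balanced in
      1# ≤ dist 0F u → 2 · 1# ≤ dist u v →
      position i ≡ u → i ℕ.≤ j → position j ≡ v → j ℕ.≤ t →
      position (suc t) ≡ 2F → suc t ℕ.≤ n → position n ≡ 0F →
      4 · 1# + 2 · x ≤ cost n
    balanced-slow {i} {j} {t} {n} {u} {v} 1≤du 2≤dv pᵢ i≤j pⱼ j≤t pₜ t<n pₙ = begin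
      4 · 1# + 2 · x                          ≈⟨ solve 1 (λ x → 4 :· con 1 :+ 2 :· x
        := con 0 :+ con 1 :+ 2 :· con 1 :+ x :+ (1 :· con 1 :+ 1 :· x)) refl x ⟩
      0# + 1# + 2 · 1# + x + (1 · 1# + 1 · x) ≤⟨ +-monoˡ-≤ _ (+-mono-≤ before cross) ⟩
      cost (suc t) + (1 · 1# + 1 · x)         ≤⟨ dist≤cost balanced-opt-packing t<n pₜ pₙ ⟩
      cost n                                  ∎
      where
      open Balanced
      open Cuts.CutPacking balanced-path-packing

      before : 0# + 1# + 2 · 1# ≤ cost t
      before = begin
        0# + 1# + 2 · 1#          ≤⟨ +-mono-≤ (+-monoʳ-≤ 0# 1≤du) 2≤dv ⟩
        0# + dist 0F u + dist u v ≤⟨ +-monoˡ-≤ _ (dist≤cost balanced-path-packing {j = i} z≤n ≡.refl pᵢ) ⟩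
        cost i + dist u v         ≤⟨ dist≤cost balanced-path-packing i≤j pᵢ pⱼ ⟩
        cost j                    ≤⟨ cost-mono balanced-path-packing j≤t ⟩
        cost t                    ∎

      into-2 : ∀ w d → Cycle.neighbour balanced w d ≡ 2F → x ≤ Cycle.edgeWeight balanced w d
      into-2 1F forward  _ = ≤-refl
      into-2 3F backward _ = ≤-refl
      into-2 0F forward ()
      into-2 0F backward ()
      into-2 1F backward ()
      into-2 2F forward ()
      into-2 2F backward ()
      into-2 3F forward ()

      cross : x ≤ Cycle.edgeWeight balanced (position t) (move t)
      cross = into-2 (position t) (move t) pₜ

    module _ {a b : NonNegative} (𝒞 : Cuts.CutPacking ℝ (fourCycle a b)) where
      open Cycle (fourCycle a b)
      open Cuts.CutPacking 𝒞
      open Exploration ℝ (fourCycle a b) 0F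
      open Run σ
      open Runs ℝ (fourCycle a b) 0F σ

      -- Here `ū` is the neighbour of 0 not yet visited. The cycles look alike except perhaps at 2
      -- and `ū`, so the run repeats the balanced run up to and including the step into 2. It pays
      -- at least 1 to reach `u`, `x` to cross and 1 to return.
      fast : ∀ {t n u ū} →
        1# ≤ dist 0F u → 1# ≤ dist 2F 0F →
        (∀ d → neighbour u d ≡ 2F → x ≤ edgeWeight u d) →
        (∀ v → v ≢ 2F → v ≢ ū → observe v ≡ Balanced.observe v) →
        (∀ i → i ℕ.≤ t → Balanced.position i ≢ 2F) →
        (∀ i → i ℕ.≤ t → Balanced.position i ≢ ū) →
        Balanced.position t ≡ u → Balanced.position (suc t) ≡ 2F → Complete n →
        2 · 1# + x ≤ cost n
      fast {t} {n} {u} 1≤d₀ᵤ 1≤d₂₀ crosses same-view ≢2 ≢ū atᵤ at₂ complete = begin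
        2 · 1# + x                       ≈⟨ solve 1 (λ x → 2 :· con 1 :+ x := con 0 :+ con 1 :+ x :+ con 1) refl x ⟩
        0# + 1# + x + 1#                 ≤⟨ +-mono-≤ (+-mono-≤ (+-monoʳ-≤ 0# 1≤d₀ᵤ) crossing) 1≤d₂₀ ⟩
        0# + dist 0F u + w + dist 2F 0F  ≤⟨ +-monoˡ-≤ _ (+-monoˡ-≤ _ (dist≤cost 𝒞 {j = t} z≤n ≡.refl at′ᵤ)) ⟩
        cost (suc t) + dist 2F 0F        ≤⟨ dist≤cost 𝒞 t<n at′₂ (proj₁ complete) ⟩
        cost n                           ∎
        where
        w = edgeWeight (position t) (move t)

        positions : ∀ i → i ℕ.≤ suc t → position i ≡ Balanced.position i
        positions i i≤1+t = position-≡ 𝓍 𝓍 a b σ i λ k k<i →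
          let k≤t = ℕ.≤-pred (ℕ.≤-trans k<i i≤1+t) in
          same-view (Balanced.position k) (≢2 k k≤t) (≢ū k k≤t)

        at′ᵤ : position t ≡ u
        at′ᵤ = ≡.trans (positions t (ℕ.n≤1+n t)) atᵤ

        at′₂ : position (suc t) ≡ 2F
        at′₂ = ≡.trans (positions (suc t) ℕ.≤-refl) at₂

        crossing : x ≤ w
        crossing = ≡.subst (λ v → ∀ d → neighbour v d ≡ 2F → x ≤ edgeWeight v d)
          (≡.sym at′ᵤ) crosses (move t) at′₂

        -- A complete run visits 2, which does not happen before time `suc t`.
        t<n : t ℕ.< n
        t<n with visits complete 2F
        ... | i , i≤n , pᵢ = ℕ.<-≤-trans (ℕ.≰⇒> λ i≤t →
          ≢2 i i≤t (≡.trans (≡.sym (positions i (ℕ.m≤n⇒m≤1+n i≤t))) pᵢ)) i≤n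

    right-fast : ∀ {t n} → let open Balanced in
      (∀ i → i ℕ.≤ t → position i ≢ 2F) → (∀ i → i ℕ.≤ t → position i ≢ 3F) →
      position t ≡ 1F → position (suc t) ≡ 2F → Right.Complete n →
      2 · 1# + x ≤ Right.cost n
    right-fast {t} {n} = fast {𝓍} {𝟘} right-packing {t} {n} {1F} {3F}
      (≤-reflexive (sym (first≈ 1#))) (≤-reflexive (sym (second≈ 1#)))
      (λ { forward _ → ≤-refl })
      λ { 0F _ _ → ≡.refl ; 1F _ _ → ≡.refl
        ; 2F ≢2 _ → ⊥-elim (≢2 ≡.refl) ; 3F _ ≢3 → ⊥-elim (≢3 ≡.refl) }

    left-fast : ∀ {t n} → let open Balanced in
      (∀ i → i ℕ.≤ t → position i ≢ 2F) → (∀ i → i ℕ.≤ t → position i ≢ 1F) →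
      position t ≡ 3F → position (suc t) ≡ 2F → Left.Complete n →
      2 · 1# + x ≤ Left.cost n
    left-fast {t} {n} = fast {𝟘} {𝓍} left-packing {t} {n} {3F} {1F}
      (≤-reflexive (sym (first≈ 1#))) (≤-reflexive (sym (second≈ 1#)))
      (λ { backward _ → ≤-refl })
      λ { 0F _ _ → ≡.refl ; 3F _ _ → ≡.refl
        ; 2F ≢2 _ → ⊥-elim (≢2 ≡.refl) ; 1F _ ≢1 → ⊥-elim (≢1 ≡.refl) }

    -- Decided by which of 1 and 3 the balanced run visits before its first arrival at 2. Both give
    -- `slow`; otherwise only the one from which it arrives has been visited, and the run is fast on
    -- that side.
    outcome : ∀ {m n o} → Balanced.Complete m → Right.Complete n → Left.Complete o →
              Outcome (Balanced.cost m) (Right.cost n) (Left.cost o)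
    outcome {m} completeᵐ completeⁿ completeᵒ with Balanced.visits completeᵐ 2F
    ... | i , i≤m , pᵢ with smallest (λ t → Balanced.position t ≟ 2F) i pᵢ
    -- The least time is not 0, as the run starts at vertex 0.
    ... | suc t , t<i , at₂ , below = conclude
      (ℕ.anyUpTo? (λ t → Balanced.position t ≟ 1F) (suc t))
      (ℕ.anyUpTo? (λ t → Balanced.position t ≟ 3F) (suc t))
      where
      open Balanced

      ≢2 : ∀ k → k ℕ.≤ t → position k ≢ 2F
      ≢2 k k≤t = below k (s≤s k≤t)

      t<m : t ℕ.< m
      t<m = ℕ.≤-trans t<i i≤m

      before-2 : ∀ w d → w ≢ 2F → Cycle.neighbour balanced w d ≡ 2F → w ≡ 1F ⊎ w ≡ 3F
      before-2 1F _ _ _ = inj₁ ≡.refl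
      before-2 2F _ ≢2 _ = ⊥-elim (≢2 ≡.refl)
      before-2 3F _ _ _ = inj₂ ≡.refl
      before-2 0F forward _ ()
      before-2 0F backward _ ()

      1∨3 : position t ≡ 1F ⊎ position t ≡ 3F
      1∨3 = before-2 (position t) (move t) (≢2 t ℕ.≤-refl) at₂

      conclude : Dec (∃[ i ] i ℕ.< suc t × position i ≡ 1F) →
                 Dec (∃[ i ] i ℕ.< suc t × position i ≡ 3F) →
                 Outcome (cost m) _ _
      conclude (yes (j , s≤s j≤t , pⱼ)) (yes (k , s≤s k≤t , pₖ)) with ℕ.≤-total j k
      ... | inj₁ j≤k = slow (balanced-slow (≤-reflexive (sym (second≈ 1#))) (≤-reflexive (sym both≈))
                               pⱼ j≤k pₖ k≤t at₂ t<m (proj₁ completeᵐ))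
      ... | inj₂ k≤j = slow (balanced-slow (≤-reflexive (sym (first≈ 1#))) (≤-reflexive (sym both≈))
                               pₖ k≤j pⱼ j≤t at₂ t<m (proj₁ completeᵐ))
      conclude _ (no ¬3) with 1∨3
      ... | inj₁ at₁ = fast-right (right-fast ≢2 (λ k k≤t pₖ → ¬3 (k , s≤s k≤t , pₖ)) at₁ at₂ completeⁿ)
      ... | inj₂ at₃ = ⊥-elim (¬3 (t , ℕ.≤-refl , at₃))
      conclude (no ¬1) _ with 1∨3
      ... | inj₁ at₁ = ⊥-elim (¬1 (t , ℕ.≤-refl , at₁))
      ... | inj₂ at₃ = fast-left (left-fast ≢2 (λ k k≤t pₖ → ¬1 (k , s≤s k≤t , pₖ)) at₃ at₂ completeᵒ)

-- Passage from bounds on runs to bounds on expectations.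

module Limits {c ℓ₁ ℓ₂ : Level} (ℝ : Reals c ℓ₁ ℓ₂) where
  open Reals ℝ hiding (zero)
  open OrderedField ℝ

  ·-assoc-* : ∀ n x y → n · x * y ≈ n · (x * y)
  ·-assoc-* zero    x y = zeroˡ y
  ·-assoc-* (suc n) x y = trans (distribʳ y x (n · x)) (+-congˡ (·-assoc-* n x y))

  -- Cotransitivity at `n · x` replaces an undecidable comparison: either `n · x` is already
  -- positive, or adding `x` increases it.
  ·-cancel-pos : ∀ n {x} → 0# < n · x → 0# < x
  ·-cancel-pos zero    0<0 = ⊥-elim (irrefl refl 0<0)
  ·-cancel-pos (suc n) {x} 0<x+nx with <-cotrans 0<x+nx (n · x)
  ... | inj₁ 0<nx    = ·-cancel-pos n 0<nx
  ... | inj₂ nx<x+nx = <-≤-trans (x<y⇒0<y-x nx<x+nx) (≤-reflexive (x+y-y≈x x (n · x)))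

  -- Takes for `ε` the quotient of `δ` by a natural number above `x`, which makes the inequality
  -- strict.
  ∃-small : ∀ {x δ} → 0# < x → 0# < δ → ∃[ ε ] 0# < ε × x * ε < δ
  ∃-small {x} {δ} 0<x 0<δ with archimedean x
  ... | n , x<n with inverse (<-trans 0<x x<n)
  ... | m , n*m≈1 = δ * m , 0<δm , (begin-strict
    x * (δ * m)        ≈⟨ *-comm x (δ * m) ⟩
    δ * m * x          <⟨ *-monoˡ-< 0<δm x<n ⟩
    δ * m * n · 1#     ≈⟨ trans (*-assoc δ m (n · 1#)) (*-congˡ (trans (*-comm m (n · 1#)) n*m≈1)) ⟩
    δ * 1#             ≈⟨ *-identityʳ δ ⟩
    δ                  ∎)
    where
    0<δm : 0# < δ * m
    -- `inverse` does not assert that `m` is positive; this follows because `n` copies of `m` sum to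
    -- 1.
    0<δm = *-pos 0<δ (·-cancel-pos n (begin-strict
      0#         <⟨ 0<1 ⟩
      1#         ≈⟨ n*m≈1 ⟨
      n · 1# * m ≈⟨ trans (·-assoc-* n 1# m) (·-cong n (*-identityˡ m)) ⟩
      n · m      ∎))
      where
      ·-cong : ∀ n {x y} → x ≈ y → n · x ≈ n · y
      ·-cong zero    x≈y = refl
      ·-cong (suc n) x≈y = +-cong x≈y (·-cong n x≈y)

  -- If `s < k`, then `ε` is chosen with `3 · k * ε` below the gap. Once all three sequences are
  -- below `ε`, the bound fails.
  ≤-limit : ∀ {k s} {a b c : ℕ → Carrier} → 0# < k → a ⟶ 0# → b ⟶ 0# → c ⟶ 0# →
            (∀ t → k ≤ s + k * (a t + (b t + c t))) → k ≤ s
  ≤-limit {k} {s} {a} {b} {c} 0<k a⟶0 b⟶0 c⟶0 bound s<k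
    with ∃-small {x = 3 · k} (<-≤-trans 0<k (x≤x+y k (·-nonneg 2 (<-asym 0<k)))) (x<y⇒0<y-x s<k)
  ... | ε , 0<ε , 3kε<k-s with a⟶0 0<ε | b⟶0 0<ε | c⟶0 0<ε
  ... | N₁ , small₁ | N₂ , small₂ | N₃ , small₃ = bound N (begin-strict
    s + k * (a N + (b N + c N)) <⟨ +-monoʳ-< s (*-monoˡ-< 0<k
                                     (+-mono-< (below small₁ (ℕ.m≤m+n N₁ _))
                                     (+-mono-< (below small₂ (ℕ.≤-trans (ℕ.m≤m+n N₂ N₃) (ℕ.m≤n+m _ N₁)))
                                               (below small₃ (ℕ.≤-trans (ℕ.m≤n+m N₃ N₂) (ℕ.m≤n+m _ N₁)))))) ⟩
    s + k * (ε + (ε + ε))       ≈⟨ +-congˡ (solve 2 (λ k ε → k :* (ε :+ (ε :+ ε)) := 3 :· k :* ε) refl k ε) ⟩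
    s + 3 · k * ε               <⟨ +-monoʳ-< s 3kε<k-s ⟩
    s + (k + - s)               ≈⟨ y≈x+[y-x] s k ⟨
    k                           ∎)
    where
    N = N₁ ℕ.+ (N₂ ℕ.+ N₃)
    below : ∀ {f : ℕ → Carrier} {M} → (∀ n → M ℕ.≤ n → f n < 0# + ε × 0# < f n + ε) →
            M ℕ.≤ N → f N < ε
    below small M≤N = <-≤-trans (proj₁ (small N M≤N)) (≤-reflexive (+-identityˡ ε))

  -- `u`, `v` and `w` indicate unfinished runs. If one of them is 1, the penalty alone reaches `k`;
  -- otherwise all three runs have ended and the hypothesis applies.
  ≤-unless : ∀ {P Q R : Set} {k s u v w} → 0# < k → 0# ≤ s → (P → Q → R → k ≤ s) →
             u ≡ 1# ⊎ (u ≡ 0# × P) → v ≡ 1# ⊎ (v ≡ 0# × Q) → w ≡ 1# ⊎ (w ≡ 0# × R) →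
             k ≤ s + k * (u + (v + w))
  ≤-unless {k = k} {s} {u} {v} {w} 0<k 0≤s k≤s = λ where
      (inj₁ ≡.refl) y z → penalty (x≤x+y 1# (+-nonneg (nonneg y) (nonneg z)))
      x (inj₁ ≡.refl) z → penalty (≤-trans (x≤x+y 1# (nonneg z)) (y≤x+y (1# + w) (nonneg x)))
      x y (inj₁ ≡.refl) → penalty (≤-trans (y≤x+y 1# (nonneg y)) (y≤x+y (v + 1#) (nonneg x)))
      x@(inj₂ (_ , p)) y@(inj₂ (_ , q)) z@(inj₂ (_ , r)) → ≤-trans (k≤s p q r) (x≤x+y s
        (*-nonneg (<-asym 0<k) (+-nonneg (nonneg x) (+-nonneg (nonneg y) (nonneg z)))))
    where
    nonneg : ∀ {x} {P : Set} → x ≡ 1# ⊎ (x ≡ 0# × P) → 0# ≤ x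
    nonneg (inj₁ ≡.refl)       = 0≤1
    nonneg (inj₂ (≡.refl , _)) = ≤-refl

    penalty : ∀ {x} → 1# ≤ x → k ≤ s + k * x
    penalty {x} 1≤x = begin
      k         ≈⟨ *-identityʳ k ⟨
      k * 1#    ≤⟨ *-monoˡ-≤ (<-asym 0<k) 1≤x ⟩
      k * x     ≤⟨ y≤x+y (k * x) 0≤s ⟩
      s + k * x ∎

  module _ {a p : Level} (space : ProbabilitySpace ℝ a p) where
    open ProbabilitySpace space

    ≤-expectation : ∀ {k r X Y Z U V W} (i : Integrable X) (j : Integrable Y) (l : Integrable Z)
      (u : Integrable U) (v : Integrable V) (w : Integrable W) →
      (∀ ω → k ≤ r * X ω + (Y ω + Z ω) + k * (U ω + (V ω + W ω))) →
      k ≤ r * E X i + (E Y j + E Z l) + k * (E U u + (E V v + E W w))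
    ≤-expectation {k} {r} {X} {Y} {Z} {U} {V} {W} i j l u v w bound = begin
      k                                ≈⟨ *-identityʳ k ⟨
      -- The constant `k` is written as a multiple of 1, since `E-one` gives the expectation of the
      -- constant 1 only.
      k * 1#                           ≈⟨ *-congˡ E-one ⟨
      k * E _ (constant 1#)            ≈⟨ E-scale k (constant 1#) ⟨
      E _ (scale k (constant 1#))      ≤⟨ E-mono (scale k (constant 1#)) (plus cost penalty) (λ ω →
                                            ≤-trans (≤-reflexive (*-identityʳ k)) (bound ω)) ⟩
      E _ (plus cost penalty)          ≈⟨ E-plus cost penalty ⟩
      E _ cost + E _ penalty           ≈⟨ +-cong
                                            (trans (E-plus (scale r i) (plus j l)) (+-cong (E-scale r i) (E-plus j l)))
                                            (trans (E-scale k (plus u (plus v w)))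
                                              (*-congˡ (trans (E-plus u (plus v w)) (+-congˡ (E-plus v w))))) ⟩
      r * E X i + (E Y j + E Z l) + k * (E U u + (E V v + E W w)) ∎
      where
      cost    = plus (scale r i) (plus j l)
      penalty = scale k (plus u (plus v w))

  module _ {a p : Level} (Alg : RandomizedAlgorithm ℝ a p) where
    open RandomizedAlgorithm Alg
    open Cycle using (Vertex; IsOpt)
    open Exploration.Run using (Complete; EndsAt) renaming (cost to runCost)

    unfinished-cases : ∀ Γ s t ω → unfinished Γ s t ω ≡ 1# ⊎
                       (unfinished Γ s t ω ≡ 0# × ∃ (EndsAt ℝ Γ s (strategy ω)))
    unfinished-cases Γ s t ω = Runs.unfinished-cases ℝ Γ s (strategy ω) t

    module _ (Γ₁ Γ₂ Γ₃ : Cycle ℝ) (s₁ : Vertex Γ₁) (s₂ : Vertex Γ₂) (s₃ : Vertex Γ₃)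
      {k r : Carrier} (0<k : 0# < k) (0≤r : 0# ≤ r)
      (k≤runs : ∀ σ {l m n} →
        Complete ℝ Γ₁ s₁ σ l → Complete ℝ Γ₂ s₂ σ m → Complete ℝ Γ₃ s₃ σ n →
        k ≤ r * runCost ℝ Γ₁ s₁ σ l + (runCost ℝ Γ₂ s₂ σ m + runCost ℝ Γ₃ s₃ σ n))
      where

      cost-bound : ∀ {X Y Z} → IsCost Γ₁ s₁ X → IsCost Γ₂ s₂ Y → IsCost Γ₃ s₃ Z → ∀ t ω →
        k ≤ r * X ω + (Y ω + Z ω) +
            k * (unfinished Γ₁ s₁ t ω + (unfinished Γ₂ s₂ t ω + unfinished Γ₃ s₃ t ω))
      cost-bound {X} {Y} {Z} isX isY isZ t ω = ≤-unless 0<k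
        (+-nonneg (*-nonneg 0≤r (proj₁ (isX ω))) (+-nonneg (proj₁ (isY ω)) (proj₁ (isZ ω))))
        (λ (l , endX) (m , endY) (n , endZ) → ≤-trans
          (k≤runs σ (proj₁ endX) (proj₁ endY) (proj₁ endZ))
          (≤-reflexive (sym (+-cong (*-congˡ (proj₂ (isX ω) l endX))
                                    (+-cong (proj₂ (isY ω) m endY) (proj₂ (isZ ω) n endZ))))))
        (unfinished-cases Γ₁ s₁ t ω)
        (unfinished-cases Γ₂ s₂ t ω)
        (unfinished-cases Γ₃ s₃ t ω)
        where σ = strategy ω

      -- The costs do not depend on `t`, while the expected penalty for unfinished runs tends to 0
      -- by `terminates`.
      expected-cost-bound : ∀ {X Y Z} (i : Integrable X) (j : Integrable Y) (l : Integrable Z) →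
        IsCost Γ₁ s₁ X → IsCost Γ₂ s₂ Y → IsCost Γ₃ s₃ Z → k ≤ r * E X i + (E Y j + E Z l)
      expected-cost-bound i j l isX isY isZ =
        ≤-limit 0<k (terminates Γ₁ s₁) (terminates Γ₂ s₂) (terminates Γ₃ s₃) λ t →
          ≤-expectation space i j l (measurable Γ₁ s₁ t) (measurable Γ₂ s₂ t) (measurable Γ₃ s₃ t)
            (cost-bound isX isY isZ t)

      -- Yao's principle with the unnormalised weights `r`, 1, 1 on the three inputs.
      competitive-bound : ∀ {o₁ o₂ o₃} → IsOpt Γ₁ o₁ → IsOpt Γ₂ o₂ → IsOpt Γ₃ o₃ →
        ∀ {ρ} → Competitive ℝ Alg ρ → k ≤ (r * o₁ + (o₂ + o₃)) * ρ
      competitive-bound {o₁} {o₂} {o₃} opt₁ opt₂ opt₃ {ρ} competitive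
        with competitive Γ₁ s₁ o₁ opt₁ | competitive Γ₂ s₂ o₂ opt₂ | competitive Γ₃ s₃ o₃ opt₃
      ... | X , i , isX , EX≤ | Y , j , isY , EY≤ | Z , l , isZ , EZ≤ = begin
        k                                ≤⟨ expected-cost-bound i j l isX isY isZ ⟩
        r * E X i + (E Y j + E Z l)      ≤⟨ +-mono-≤ (*-monoˡ-≤ 0≤r EX≤) (+-mono-≤ EY≤ EZ≤) ⟩
        r * (ρ * o₁) + (ρ * o₂ + ρ * o₃) ≈⟨ solve 5 (λ r ρ x y z → r :* (ρ :* x) :+ (ρ :* y :+ ρ :* z)
                                              := (r :* x :+ (y :+ z)) :* ρ) refl r ρ o₁ o₂ o₃ ⟩
        (r * o₁ + (o₂ + o₃)) * ρ         ∎

-- Evaluation of the bound at the optimal weights.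

module LowerBound {c ℓ₁ ℓ₂ : Level} (ℝ : Reals c ℓ₁ ℓ₂) where
  open Reals ℝ hiding (zero)
  open OrderedField ℝ
  open Limits ℝ
  open FourCycles ℝ

  0≤√2×√2²≈2 : 0# ≤ √2 × √2 * √2 ≈ 2 · 1#
  0≤√2×√2²≈2 = proj₂ (sqrt _)

  0≤√2 : 0# ≤ √2
  0≤√2 = proj₁ 0≤√2×√2²≈2

  √2²≈2 : √2 * √2 ≈ 2 · 1#
  √2²≈2 = proj₂ 0≤√2×√2²≈2

  -- For weight x and multiplicities 1, 2 / (x - 2), 2 / (x - 2) of the three cycles
  -- the ratio exceeds 1 by 1 / (1 + x + 8 / (x - 2)), which is largest at this x.
  heavy : NonNegative
  heavy = 2 · 1# + 2 · √2 , +-nonneg (·-nonneg 2 0≤1) (·-nonneg 2 0≤√2)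

  2≤heavy : 2 · 1# ≤ proj₁ heavy
  2≤heavy = x≤x+y (2 · 1#) (·-nonneg 2 0≤√2)

  open HeavyCycles ℝ heavy 2≤heavy

  -- The weighted total in the slow and in the fast case alike. Over the optima, a slow run pays 2
  -- more in the balanced cycle, which has weight `√2`; a fast one pays `x - 2`, again `2 · √2`,
  -- more in one of the others.
  budget : Carrier
  budget = 16 · 1# + 8 · √2

  0<budget : 0# < budget
  0<budget = <-≤-trans 0<1 (≤-trans (x≤x+y 1# (·-nonneg 15 0≤1)) (x≤x+y (16 · 1#) (·-nonneg 8 0≤√2)))

  -- The semiring solver treats `√2` as a variable, so the relation that its square is 2 enters the
  -- computations here.
  reduce-√2² : ∀ m n → m · 1# + n · √2 + 4 · (√2 * √2) ≈ m · 1# + n · √2 + 4 · (2 · 1#)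
  reduce-√2² m n = +-congˡ (four √2²≈2)
    where
    four : ∀ {x y} → x ≈ y → 4 · x ≈ 4 · y
    four x≈y = +-cong x≈y (+-cong x≈y (+-cong x≈y (+-congʳ x≈y)))

  slow-total : budget ≈ √2 * (4 · 1# + 2 · proj₁ heavy) + (2 · 1# + 2 · 1# + (2 · 1# + 2 · 1#))
  slow-total = begin-equality
    16 · 1# + 8 · √2 ≈⟨ solve 1 (λ r → 16 :· con 1 :+ 8 :· r := 8 :· con 1 :+ 8 :· r :+ 4 :· (2 :· con 1)) refl √2 ⟩
    8 · 1# + 8 · √2 + 4 · (2 · 1#)  ≈⟨ reduce-√2² 8 8 ⟨
    8 · 1# + 8 · √2 + 4 · (√2 * √2) ≈⟨ solve 1 (λ r → 8 :· con 1 :+ 8 :· r :+ 4 :· (r :* r)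
       := r :* (4 :· con 1 :+ 2 :· (2 :· con 1 :+ 2 :· r)) :+ (2 :· con 1 :+ 2 :· con 1 :+ (2 :· con 1 :+ 2 :· con 1))) refl √2 ⟩
    _ ∎

  fast-total : budget ≈ √2 * (2 · 1# + 2 · proj₁ heavy) + (2 · 1# + proj₁ heavy + (2 · 1# + 2 · 1#))
  fast-total = begin-equality
    16 · 1# + 8 · √2 ≈⟨ solve 1 (λ r → 16 :· con 1 :+ 8 :· r := 8 :· con 1 :+ 8 :· r :+ 4 :· (2 :· con 1)) refl √2 ⟩
    8 · 1# + 8 · √2 + 4 · (2 · 1#)  ≈⟨ reduce-√2² 8 8 ⟨
    8 · 1# + 8 · √2 + 4 · (√2 * √2) ≈⟨ solve 1 (λ r → 8 :· con 1 :+ 8 :· r :+ 4 :· (r :* r)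
       := r :* (2 :· con 1 :+ 2 :· (2 :· con 1 :+ 2 :· r)) :+ (2 :· con 1 :+ (2 :· con 1 :+ 2 :· r) :+ (2 :· con 1 :+ 2 :· con 1))) refl √2 ⟩
    _ ∎

  -- In each outcome one cycle is charged its surplus, and the other two only their optima.
  runs≥budget : ∀ {A R L} → 2 · 1# + 2 · proj₁ heavy ≤ A →
    2 · 1# + 2 · 1# ≤ R → 2 · 1# + 2 · 1# ≤ L →
    Outcome A R L → budget ≤ √2 * A + (R + L)
  runs≥budget A≥ R≥ L≥ (slow A≥′) = ≤-trans (≤-reflexive slow-total)
    (+-mono-≤ (*-monoˡ-≤ 0≤√2 A≥′) (+-mono-≤ R≥ L≥))
  runs≥budget A≥ R≥ L≥ (fast-right R≥′) = ≤-trans (≤-reflexive fast-total)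
    (+-mono-≤ (*-monoˡ-≤ 0≤√2 A≥) (+-mono-≤ R≥′ L≥))
  runs≥budget A≥ R≥ L≥ (fast-left L≥′) = ≤-trans
    (≤-reflexive (trans fast-total (+-congˡ (+-comm (2 · 1# + proj₁ heavy) (2 · 1# + 2 · 1#)))))
    (+-mono-≤ (*-monoˡ-≤ 0≤√2 A≥) (+-mono-≤ R≥ L≥′))

  optima : Carrier
  optima = √2 * (2 · 1# + 2 · proj₁ heavy) + (2 · 1# + 2 · 1# + (2 · 1# + 2 · 1#))

  0<optima : 0# < optima
  0<optima = <-≤-trans 0<1 (≤-trans (x≤x+y 1# (·-nonneg 3 0≤1))
    (≤-trans (≤-reflexive (solve 0 (4 :· con 1 := 2 :· con 1 :+ 2 :· con 1) refl))
      (≤-trans (x≤x+y _ (+-nonneg (·-nonneg 2 0≤1) (·-nonneg 2 0≤1)))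
        (y≤x+y _ (*-nonneg 0≤√2 (+-nonneg (·-nonneg 2 0≤1) (·-nonneg 2 (proj₂ heavy))))))))

  optima≈ : optima ≈ 2 · (8 · 1# + 3 · √2)
  optima≈ = begin-equality
    optima ≈⟨ solve 1 (λ r →
       r :* (2 :· con 1 :+ 2 :· (2 :· con 1 :+ 2 :· r)) :+ (2 :· con 1 :+ 2 :· con 1 :+ (2 :· con 1 :+ 2 :· con 1))
       := 8 :· con 1 :+ 6 :· r :+ 4 :· (r :* r)) refl √2 ⟩
    8 · 1# + 6 · √2 + 4 · (√2 * √2) ≈⟨ reduce-√2² 8 6 ⟩
    8 · 1# + 6 · √2 + 4 · (2 · 1#)  ≈⟨ solve 1 (λ r → 8 :· con 1 :+ 6 :· r :+ 4 :· (2 :· con 1)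
       := 2 :· (8 :· con 1 :+ 3 :· r)) refl √2 ⟩
    2 · (8 · 1# + 3 · √2) ∎

  ratio : Carrier
  ratio = 1# + √2 / (8 · 1# + 3 · √2) [ 0<8+3√2 ]

  -- With `d` the denominator, the optima total `2 · d` and the budget exceeds this by `2 · √2`.
  budget≈ratio*optima : budget ≈ optima * ratio
  budget≈ratio*optima with inverse 0<8+3√2
  ... | q , denominator*q≈1 = sym (begin-equality
    optima * (1# + √2 * q)               ≈⟨ *-congʳ optima≈ ⟩
    2 · d * (1# + √2 * q)  ≈⟨ solve 3 (λ d r q → 2 :· d :* (con 1 :+ r :* q) := 2 :· d :+ 2 :· r :* (d :* q)) refl d √2 q ⟩
    2 · d + 2 · √2 * (d * q)             ≈⟨ +-congˡ (trans (*-congˡ denominator*q≈1) (*-identityʳ (2 · √2))) ⟩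
    2 · d + 2 · √2                       ≈⟨ solve 1 (λ r → 2 :· (8 :· con 1 :+ 3 :· r) :+ 2 :· r := 16 :· con 1 :+ 8 :· r) refl √2 ⟩
    budget                               ∎)
    where d = 8 · 1# + 3 · √2

  run-cost≥budget : ∀ σ {m n o} → Balanced.Complete σ m → Right.Complete σ n → Left.Complete σ o →
    budget ≤ √2 * Balanced.cost σ m + (Right.cost σ n + Left.cost σ o)
  run-cost≥budget σ completeᵇ completeʳ completeˡ = runs≥budget
    (Balanced.complete⇒≤cost σ balanced-opt-packing splits-0 splits-2 completeᵇ)
    (Right.complete⇒≤cost σ right-packing splits-1 splits-01 completeʳ)
    (Left.complete⇒≤cost σ left-packing splits-3 splits-03 completeˡ)
    (outcome σ completeᵇ completeʳ completeˡ)

  -- The conclusion unfolds to a negation: a `ρ` below `ratio`, multiplied by the positive `optima`,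
  -- falls short of `budget` and contradicts `competitive-bound`.
  competitiveRatio≥ratio : ∀ {a p : Level} (Alg : RandomizedAlgorithm ℝ a p) →
                           CompetitiveRatioAtLeast ℝ Alg ratio
  competitiveRatio≥ratio Alg ρ competitive ρ<ratio =
    competitive-bound Alg balanced right left 0F 0F 0F 0<budget 0≤√2 run-cost≥budget
      balanced-opt right-opt left-opt competitive (begin-strict
        optima * ρ     <⟨ *-monoˡ-< 0<optima ρ<ratio ⟩
        optima * ratio ≈⟨ budget≈ratio*optima ⟨
        budget         ∎)

theorem3 : ∀ {c ℓ₁ ℓ₂ a p : Level} (ℝ : Reals c ℓ₁ ℓ₂) (Alg : RandomizedAlgorithm ℝ a p) →
    let open Reals ℝ in
    CompetitiveRatioAtLeast ℝ Alg (1# + √2 / (8 · 1# + 3 · √2) [ 0<8+3√2 ])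
theorem3 ℝ Alg = LowerBound.competitiveRatio≥ratio ℝ Alg
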